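{- Let $(S,\ast)$ be an adequate partial semigroup and let $A\subseteq S$. If there is an idempotent $p\in\overline{A}\cap J_\delta(S)$, then there is a nonempty set $T$ of functions such that (i) for all $f\in T$, $\mathrm{domain}(f)\in\omega$ and $\mathrm{range}(f)\subseteq A$; (ii) for all $f\in T$ and all $x\in B_f(T)$, $B_{f^\frown x}(T)\subseteq x^{ -1}B_f(T)$; (iii) for all $F\in\mathcal{P}_f(T)$, $\bigcap_{f\in F}B_f(T)$ is a $J_\delta$-set. Moreover, there is a downward directed family $\langle A_F\rangle_{F\in I}$ of subsets of $A$ such that (a) for all $F\in I$ and all $x\in A_F$ there exists $G\in I$ with $A_G\subseteq x^{ -1}A_F$; (b) for each $\mathcal{F}\in\mathcal{P}_f(I)$, $\bigcap_{F\in\mathcal{F}}A_F$ is a $J_\delta$-set.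
   Context: A partial semigroup is a pair $(S,\ast)$ where $\ast$ is an operation defined on a subset of $S\times S$ such that $(x\ast y)\ast z=x\ast(y\ast z)$ in the sense that if either side is defined, so is the other and they are equal. $\phi_S(s)=\{t: s\ast t\text{ defined}\}$, $\sigma_S(H)=\bigcap_{s\in H}\phi_S(s)$ for $H\in\mathcal{P}_f(S)$ (finite nonempty subsets); $S$ is adequate if all $\sigma_S(H)\ne\emptyset$. $\overline{A}=\{p\in\beta S: A\in p\}$. $\delta S=\bigcap_{x\in S}\overline{\phi_S(x)}$, with operation $p\ast q=\{B\subseteq S:\{s: s^{ -1}B\in q\}\in p\}$, where $s^{ -1}B=\{t\in\phi_S(s): s\ast t\in B\}$. A sequence $\langle y_n\rangle$ in $S$ is adequate if $\prod_{n\in F}y_n$ is defined for every $F\in\mathcal{P}_f(\mathbb{N})$ and for every $K\in\mathcal{P}_f(S)$ there is $m$ with $\prod_{n\in F}y_n\in\sigma_S(K)$ whenever $\min F\ge m$; $\mathcal{T}_S$ is the set of adequate sequences. For $W\in\mathcal{P}_f(S)$, $a\in S$, $W\ast a=\{w\ast a: w\in W,\ w\ast a\text{ defined}\}$. $B\subseteq S$ is a $J_\delta$-set if for every $F\in\mathcal{P}_f(\mathcal{T}_S)$ and $W\in\mathcal{P}_f(S)$ there exist $a\in\sigma_S(W)$ and $H\in\mathcal{P}_f(\mathbb{N})$ with $\prod_{t\in H}f(t)\in\sigma_S(W\ast a)$ and $a\ast\prod_{t\in H}f(t)\in B$ for each $f\in F$; $J_\delta(S)=\{p\in\delta S:\text{every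 member of }p\text{ is a }J_\delta\text{ -set}\}$. $\omega$ is the first infinite ordinal, $[n]=\{0,\dots,n-1\}$. For $f$ with domain $[n]$ and $x\in S$, $f^\frown x=f\cup\{(n,x)\}$. For a set $T$ of such functions and $f\in T$, $B_f(T)=\{x: f^\frown x\in T\}$. A family $\langle A_F\rangle_{F\in I}$ is downward directed if for all $F,G\in I$ there is $H\in I$ with $A_H\subseteq A_F\cap A_G$. -}

module Defs where

open import Level using (Level; suc)
open import Data.Empty.Polymorphic using (⊥)
open import Data.List.Membership.Propositional using () renaming (_∈_ to _∈ˡ_)
open import Data.List.NonEmpty using (List⁺; [_]; _∷⁺_; head; toList)
  renaming (map to map⁺)
open import Data.List.Relation.Unary.Linked using (Linked)
open import Data.Nat using (ℕ; _≤_; _<_)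
open import Data.Product using (∃; ∃₂; _×_)
open import Data.Sum using (_⊎_)
open import Data.Unit.Polymorphic using (⊤)
open import Data.Vec using (Vec; lookup; _∷ʳ_)
open import Function.Bundles using (_⇔_)
open import Relation.Binary.PropositionalEquality using (_≡_)
open import Relation.Unary
  using (Pred; _∈_; _∉_; _⊆_; _≐_; _∩_; ∁; Satisfiable)

private
  variable
    ℓ : Level

-- A finite nonempty subset is presented by a nonempty list enumerating it,
-- in any order and possibly with repetitions; only membership is ever used.
⟦_⟧ : {X : Set ℓ} → List⁺ X → Pred X ℓ
⟦ xs ⟧ x = x ∈ˡ toList xs

⋂[_] : {I X : Set ℓ} → List⁺ I → (I → Pred X ℓ) → Pred X ℓ
⋂[ F ] A = λ x → ∀ {i} → i ∈ ⟦ F ⟧ → x ∈ A i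

-- Finite nonempty sets of naturals index ordered products, so they are
-- presented by their increasing enumeration.
record Pf-ℕ : Set where
  field
    elements   : List⁺ ℕ
    increasing : Linked _<_ (toList elements)

  min : ℕ
  min = head elements

record IsUltrafilter {X : Set ℓ} (p : Pred (Pred X ℓ) ℓ) : Set (suc ℓ) where
  field
    whole  : (λ _ → ⊤) ∈ p
    proper : (λ _ → ⊥) ∉ p
    upward : ∀ {A B : Pred X ℓ} → A ⊆ B → A ∈ p → B ∈ p
    inter  : ∀ {A B : Pred X ℓ} → A ∈ p → B ∈ p → A ∩ B ∈ p
    ultra  : ∀ (A : Pred X ℓ) → A ∈ p ⊎ ∁ A ∈ p

record β (X : Set ℓ) : Set (suc ℓ) where
  field
    members       : Pred (Pred X ℓ) ℓ
    isUltrafilter : IsUltrafilter members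

open β public using (members)

closure : {X : Set ℓ} → Pred X ℓ → Pred (β X) ℓ
closure A p = A ∈ members p

-- The partial operation is given by its graph: s ∗ t ↦ u means that s ∗ t is
-- defined and equal to u.
record PartialSemigroup ℓ : Set (suc ℓ) where
  field
    Carrier    : Set ℓ
    _∗_↦_      : Carrier → Carrier → Carrier → Set ℓ
    functional : ∀ {s t u v} → s ∗ t ↦ u → s ∗ t ↦ v → u ≡ v
    assoc      : ∀ x y z w →
                 (∃ λ u → x ∗ y ↦ u × u ∗ z ↦ w) ⇔
                 (∃ λ v → y ∗ z ↦ v × x ∗ v ↦ w)

module _ (S : PartialSemigroup ℓ) where
  open PartialSemigroup S

  φ : Carrier → Pred Carrier ℓ
  φ s t = ∃ λ u → s ∗ t ↦ u

  σ : Pred Carrier ℓ → Pred Carrier ℓ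
  σ H t = ∀ {s} → s ∈ H → t ∈ φ s

  IsAdequate : Set ℓ
  IsAdequate = ∀ (H : List⁺ Carrier) → Satisfiable (σ ⟦ H ⟧)

  -- translate s B is s⁻¹B = { t ∈ φ s : s ∗ t ∈ B }.
  translate : Carrier → Pred Carrier ℓ → Pred Carrier ℓ
  translate s B t = ∃ λ u → s ∗ t ↦ u × u ∈ B

  -- rightMultiples W a is W ∗ a = { w ∗ a : w ∈ W, w ∗ a defined }.
  rightMultiples : Pred Carrier ℓ → Carrier → Pred Carrier ℓ
  rightMultiples W a u = ∃ λ w → w ∈ W × w ∗ a ↦ u

  δ : Pred (β Carrier) ℓ
  δ p = ∀ x → p ∈ closure (φ x)

  product : β Carrier → β Carrier → Pred (Pred Carrier ℓ) ℓ
  product p q B = (λ s → translate s B ∈ members q) ∈ members p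

  IsIdempotent : β Carrier → Set (suc ℓ)
  IsIdempotent p = product p p ≐ members p

  -- ListProduct xs z: the product of xs, in the order listed, is defined and
  -- equal to z. By associativity the choice of bracketing is immaterial.
  data ListProduct : List⁺ Carrier → Carrier → Set ℓ where
    single : ∀ {x} → ListProduct [ x ] x
    cons   : ∀ {x xs y z} →
             ListProduct xs y → x ∗ y ↦ z → ListProduct (x ∷⁺ xs) z

  -- ∏ f over H ↦ z: the product of f(t) over t ∈ H, in increasing order of t, is
  -- defined and equal to z.
  ∏_over_↦_ : (ℕ → Carrier) → Pf-ℕ → Carrier → Set ℓ
  ∏ f over H ↦ z = ListProduct (map⁺ f (Pf-ℕ.elements H)) z

  record IsAdequateSequence (y : ℕ → Carrier) : Set ℓ where
    field
      defined  : ∀ F → ∃ λ z → ∏ y over F ↦ z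
      adequate : ∀ (K : List⁺ Carrier) → ∃ λ m → ∀ F → m ≤ Pf-ℕ.min F →
                 ∃ λ z → (∏ y over F ↦ z) × z ∈ σ ⟦ K ⟧

  IsJδSet : Pred Carrier ℓ → Set ℓ
  IsJδSet B =
    ∀ (F : List⁺ (ℕ → Carrier)) → ⟦ F ⟧ ⊆ IsAdequateSequence →
    ∀ (W : List⁺ Carrier) →
    ∃₂ λ (a : Carrier) (H : Pf-ℕ) →
      a ∈ σ ⟦ W ⟧ ×
      (∀ {f} → f ∈ ⟦ F ⟧ →
        ∃ λ z → (∏ f over H ↦ z) ×
                z ∈ σ (rightMultiples ⟦ W ⟧ a) ×
                z ∈ translate a B)

  Jδ : Pred (β Carrier) (suc ℓ)
  Jδ p = p ∈ δ × members p ⊆ IsJδSet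

-- A function with domain {0, …, n−1} for some n ∈ ω. Vectors are used rather
-- than maps Fin n → X so that propositional equality is equality of functions.
record FinSeq (X : Set ℓ) : Set ℓ where
  constructor finSeq
  field
    {domain} : ℕ
    values   : Vec X domain

range : {X : Set ℓ} → FinSeq X → Pred X ℓ
range (finSeq v) x = ∃ λ i → lookup v i ≡ x

infixl 6 _⌢_
_⌢_ : {X : Set ℓ} → FinSeq X → X → FinSeq X
finSeq v ⌢ x = finSeq (v ∷ʳ x)

B⟨_⟩ : {X : Set ℓ} → FinSeq X → Pred (FinSeq X) ℓ → Pred X ℓ
B⟨ f ⟩ T x = f ⌢ x ∈ T

-- As usual for directed families, the index set is required to be nonempty.
DownwardDirected : {I X : Set ℓ} → (I → Pred X ℓ) → Set ℓ
DownwardDirected {I = I} A = I × (∀ F G → ∃ λ H → A H ⊆ A F ∩ A G)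

{-# OPTIONS --safe #-}

-- For an idempotent p with A ∈ p, let A* = { x ∈ A : x⁻¹A ∈ p }. Then A* ∈ p and
-- x⁻¹A* ∈ p for every x ∈ A*. This property of a set C passes to C ∩ x⁻¹C when
-- x ∈ C, so starting from C_∅ = A* and putting C_{f⌢x} = C_f ∩ x⁻¹C_f, the tree of
-- all sequences that choose each new entry x from C_f has B_f = C_f ∈ p, and
-- every member of p is a J_δ-set. The directed family consists of the finite
-- intersections of the sets B_f.
module Submission where

open import Defs
open import Data.Fin using (zero; suc)
open import Data.List.Base using ([]; _∷_)
open import Data.List.Membership.Propositional.Properties
  using (∈-map⁺; ∈-map⁻; ∈-++⁺ˡ; ∈-++⁺ʳ; ∈-++⁻)
open import Data.List.NonEmpty using (List⁺; _∷_; _⁺++⁺_; [_]; toList)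
  renaming (map to map⁺)
open import Data.List.Relation.Unary.Any using (here; there)
open import Data.Product using (Σ-syntax; ∃-syntax; _×_; _,_; proj₁; proj₂)
open import Data.Sum using ([_,_]′)
open import Data.Unit.Polymorphic using (⊤; tt)
open import Data.Vec using (Vec; []; _∷_; _∷ʳ_; lookup)
open import Function using (_∘_)
open import Function.Bundles using (Equivalence)
open import Relation.Binary.PropositionalEquality using (refl)
open import Relation.Unary using (Pred; _∈_; _⊆_; _∩_; Satisfiable)

⋂-∈-members : ∀ {ℓ} {I X : Set ℓ} (p : β X) (F : List⁺ I) {B : I → Pred X ℓ} →
  (∀ {i} → i ∈ ⟦ F ⟧ → B i ∈ members p) → ⋂[ F ] B ∈ members p
⋂-∈-members p (i ∷ is) {B} = go i is
  where
  open IsUltrafilter (β.isUltrafilter p)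

  go : ∀ i is → (∀ {j} → j ∈ ⟦ i ∷ is ⟧ → B j ∈ members p) →
    ⋂[ i ∷ is ] B ∈ members p
  go i []       B∈p = upward (λ { b (here refl) → b }) (B∈p (here refl))
  go i (j ∷ js) B∈p =
    upward (λ { (b , bs) (here refl) → b ; (b , bs) (there k∈) → bs k∈ })
      (inter (B∈p (here refl)) (go j js (B∈p ∘ there)))

module _ {ℓ} (S : PartialSemigroup ℓ) where
  open PartialSemigroup S

  translate-mono : ∀ {x} {B C : Pred Carrier ℓ} → B ⊆ C →
    translate S x B ⊆ translate S x C
  translate-mono B⊆C (u , x∗t , u∈B) = u , x∗t , B⊆C u∈B

  translate-∩ : ∀ {x} {B C : Pred Carrier ℓ} →
    translate S x B ∩ translate S x C ⊆ translate S x (B ∩ C)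
  translate-∩ ((u , x∗t , u∈B) , (v , x∗t′ , v∈C))
    with refl ← functional x∗t x∗t′ = u , x∗t , u∈B , v∈C

  -- Nonemptiness of `F` matters here: its first index supplies the product `u`, and functionality
  -- identifies the products coming from all other indices with this one.
  translate-⋂ : ∀ {I : Set ℓ} {x} (F : List⁺ I) {B : I → Pred Carrier ℓ} →
    ⋂[ F ] (translate S x ∘ B) ⊆ translate S x (⋂[ F ] B)
  translate-⋂ (i ∷ is) {B} t∈ with t∈ (here refl)
  ... | u , x∗t , _ = u , x∗t , u∈
    where
    u∈ : u ∈ ⋂[ i ∷ is ] B
    u∈ j∈ with v , x∗t′ , v∈ ← t∈ j∈
      with refl ← functional x∗t x∗t′ = v∈

  -- Partial associativity also transfers definedness: once `x ∗ y` and `(x ∗ y) ∗ t` exist, so do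
  -- `y ∗ t` and `x ∗ (y ∗ t)`.
  translate-∗⁺ : ∀ {x y u} {B : Pred Carrier ℓ} → x ∗ y ↦ u →
    translate S u B ⊆ translate S y (translate S x B)
  translate-∗⁺ x∗y (w , u∗t , w∈B)
    with v , y∗t , x∗v ← Equivalence.to (assoc _ _ _ _) (_ , x∗y , u∗t) =
    v , y∗t , w , x∗v , w∈B

  translate-∗⁻ : ∀ {x y u} {B : Pred Carrier ℓ} → x ∗ y ↦ u →
    translate S y (translate S x B) ⊆ translate S u B
  translate-∗⁻ x∗y (v , y∗t , w , x∗v , w∈B)
    with u , x∗y′ , u∗t ← Equivalence.from (assoc _ _ _ _) (v , y∗t , x∗v)
    with refl ← functional x∗y x∗y′ = w , u∗t , w∈B

  refine : Pred Carrier ℓ → Carrier → Pred Carrier ℓ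
  refine C x = C ∩ translate S x C

  -- This is C_f for the starting set `C`. The recursion consumes the vector from the front and
  -- shrinks `C`, so facts proved for every `C` pass through it directly. Since `⌢` appends at the
  -- back, the `∷ʳ` lemmas below reconcile the two ends.
  residual : ∀ {n} → Pred Carrier ℓ → Vec Carrier n → Pred Carrier ℓ
  residual C []      = C
  residual C (x ∷ v) = residual (refine C x) v

  Branch : ∀ {n} → Pred Carrier ℓ → Vec Carrier n → Set ℓ
  Branch C []      = ⊤
  Branch C (x ∷ v) = x ∈ C × Branch (refine C x) v

  tree : Pred Carrier ℓ → Pred (FinSeq Carrier) ℓ
  tree C (finSeq v) = Branch C v

  residual-∷ʳ : ∀ {n C} (v : Vec Carrier n) {x} →
    residual C (v ∷ʳ x) ⊆ refine (residual C v) x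
  residual-∷ʳ []      y∈ = y∈
  residual-∷ʳ (_ ∷ v) y∈ = residual-∷ʳ v y∈

  Branch-∷ʳ⁺ : ∀ {n C} (v : Vec Carrier n) {x} →
    Branch C v → x ∈ residual C v → Branch C (v ∷ʳ x)
  Branch-∷ʳ⁺ []      _         x∈ = x∈ , tt
  Branch-∷ʳ⁺ (_ ∷ v) (y∈ , br) x∈ = y∈ , Branch-∷ʳ⁺ v br x∈

  Branch-∷ʳ⁻ : ∀ {n C} (v : Vec Carrier n) {x} →
    Branch C (v ∷ʳ x) → x ∈ residual C v
  Branch-∷ʳ⁻ []      (x∈ , _) = x∈
  Branch-∷ʳ⁻ (_ ∷ v) (_ , br) = Branch-∷ʳ⁻ v br

  Branch-lookup : ∀ {n C} (v : Vec Carrier n) → Branch C v → ∀ i → lookup v i ∈ C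
  Branch-lookup (_ ∷ _) (x∈ , _) zero    = x∈
  Branch-lookup (_ ∷ v) (_ , br) (suc i) = proj₁ (Branch-lookup v br i)

  residual-⊆ : ∀ {n C} (v : Vec Carrier n) → residual C v ⊆ C
  residual-⊆ []      y∈ = y∈
  residual-⊆ (_ ∷ v) y∈ = proj₁ (residual-⊆ v y∈)

  B-tree-⊆ : ∀ {C} f → B⟨ f ⟩ (tree C) ⊆ C
  B-tree-⊆ (finSeq v) = residual-⊆ v ∘ Branch-∷ʳ⁻ v

  range-tree : ∀ {C f} → f ∈ tree C → range f ⊆ C
  range-tree {f = finSeq v} br (i , refl) = Branch-lookup v br i

  -- The chain is B_{f⌢x} ⊆ C_{f⌢x} ⊆ x⁻¹C_f ⊆ x⁻¹B_f; the last inclusion is where `f ∈ tree C`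
  -- enters.
  B-tree-⌢ : ∀ {C f} → f ∈ tree C → ∀ {x} →
    B⟨ f ⌢ x ⟩ (tree C) ⊆ translate S x (B⟨ f ⟩ (tree C))
  B-tree-⌢ {f = finSeq v} br {x} y∈ =
    translate-mono (Branch-∷ʳ⁺ v br)
      (proj₂ (residual-∷ʳ v (Branch-∷ʳ⁻ (v ∷ʳ x) y∈)))

  module _ (p : β Carrier) where
    open IsUltrafilter (β.isUltrafilter p)

    record IsStarSet (C : Pred Carrier ℓ) : Set ℓ where
      constructor _,_
      field
        large      : C ∈ members p
        translates : ∀ {x} → x ∈ C → translate S x C ∈ members p

    open IsStarSet

    star : Pred Carrier ℓ → Pred Carrier ℓ
    star A x = x ∈ A × translate S x A ∈ members p

    -- Idempotence is applied twice: to `A`, making the star large, and to x⁻¹A, giving p-many `y`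
    -- with y⁻¹(x⁻¹A) in `p`. For such `y` in x⁻¹A, associativity puts (x∗y)⁻¹A in `p`, so `x ∗ y`
    -- lies in the star.
    star-isStarSet : IsIdempotent S p → ∀ {A} → A ∈ members p → IsStarSet (star A)
    star-isStarSet (_ , p⊆p∗p) A∈p = inter A∈p (p⊆p∗p A∈p) , λ (_ , x⁻¹A∈p) →
      upward
        (λ ((u , x∗y , u∈A) , y⁻¹x⁻¹A∈p) →
          u , x∗y , u∈A , upward (translate-∗⁻ x∗y) y⁻¹x⁻¹A∈p)
        (inter x⁻¹A∈p (p⊆p∗p x⁻¹A∈p))

    -- For `y` in the refined set, both `y` and `u = x ∗ y` lie in `C`, so y⁻¹C and u⁻¹C belong to
    -- `p`. Since u⁻¹C ⊆ y⁻¹(x⁻¹C), their intersection lies inside y⁻¹(C ∩ x⁻¹C).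
    refine-isStarSet : ∀ {C x} → IsStarSet C → x ∈ C → IsStarSet (refine C x)
    refine-isStarSet C* x∈C =
      inter (large C*) (translates C* x∈C) , λ (y∈C , u , x∗y , u∈C) →
        upward translate-∩
          (inter (translates C* y∈C)
                 (upward (translate-∗⁺ x∗y) (translates C* u∈C)))

    residual-∈-members : ∀ {n C} (v : Vec Carrier n) → IsStarSet C → Branch C v →
      residual C v ∈ members p
    residual-∈-members []      C* _          = large C*
    residual-∈-members (x ∷ v) C* (x∈C , br) =
      residual-∈-members v (refine-isStarSet C* x∈C) br

    B-tree-∈-members : ∀ {C f} → IsStarSet C → f ∈ tree C →
      B⟨ f ⟩ (tree C) ∈ members p
    B-tree-∈-members {f = finSeq v} C* br =
      upward (Branch-∷ʳ⁺ v br) (residual-∈-members v C* br)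

theorem4p4 : ∀ {ℓ} (S : PartialSemigroup ℓ) (let open PartialSemigroup S) →
  IsAdequate S →
  (A : Pred Carrier ℓ) →
  (∃[ p ] (p ∈ closure A ∩ Jδ S × IsIdempotent S p)) →
  (Σ[ T ∈ Pred (FinSeq Carrier) ℓ ]
    Satisfiable T ×
    (∀ {f} → f ∈ T → range f ⊆ A) ×
    (∀ {f} → f ∈ T → ∀ {x} → x ∈ B⟨ f ⟩ T →
      B⟨ f ⌢ x ⟩ T ⊆ translate S x (B⟨ f ⟩ T)) ×
    (∀ (F : List⁺ (FinSeq Carrier)) → ⟦ F ⟧ ⊆ T →
      IsJδSet S (⋂[ F ] (λ f → B⟨ f ⟩ T))))
  ×
  (Σ[ I ∈ Set ℓ ] Σ[ 𝒜 ∈ (I → Pred Carrier ℓ) ]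
    (∀ F → 𝒜 F ⊆ A) ×
    DownwardDirected 𝒜 ×
    (∀ F {x} → x ∈ 𝒜 F → ∃[ G ] (𝒜 G ⊆ translate S x (𝒜 F))) ×
    (∀ (𝓕 : List⁺ I) → IsJδSet S (⋂[ 𝓕 ] 𝒜)))
theorem4p4 {ℓ} S _ A (p , (A∈p , _ , p⊆Jδ) , idem) =
  ( T
  , (finSeq [] , tt)
  , (λ f∈T → proj₁ ∘ range-tree S f∈T)
  , (λ f∈T _ → B-tree-⌢ S f∈T)
  , (λ F F⊆T → p⊆Jδ (⋂B∈p (F , F⊆T))))
  , ( I , 𝒜
    -- One member `f` of the nonempty list suffices: B_f lies in the star of `A`, hence in `A`.
    , (λ { (f ∷ _ , _) x∈ → proj₁ (B-tree-⊆ S f (x∈ (here refl))) })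
    , ( ([ finSeq [] ] , λ { (here refl) → tt })
      , λ (F , F⊆T) (G , G⊆T) →
          -- Concatenating the lists of sequences intersects the corresponding sets.
          (F ⁺++⁺ G , [ F⊆T , G⊆T ]′ ∘ ∈-++⁻ (toList F))
          , λ x∈ → (λ f∈F → x∈ (∈-++⁺ˡ f∈F)) , (λ g∈G → x∈ (∈-++⁺ʳ (toList F) g∈G)))
    , shift
    -- Each `𝒜 F` is itself in `p`, so a finite intersection of them is too.
    , (λ 𝓕 → p⊆Jδ (⋂-∈-members p 𝓕 (λ {F} _ → ⋂B∈p F))))
  where
  open PartialSemigroup S

  T : Pred (FinSeq Carrier) ℓ
  T = tree S (star S p A)

  I : Set ℓ
  I = Σ[ F ∈ List⁺ (FinSeq Carrier) ] ⟦ F ⟧ ⊆ T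

  𝒜 : I → Pred Carrier ℓ
  𝒜 (F , _) = ⋂[ F ] (λ f → B⟨ f ⟩ T)

  ⋂B∈p : ∀ F → 𝒜 F ∈ members p
  ⋂B∈p (F , F⊆T) = ⋂-∈-members p F
    (λ f∈F → B-tree-∈-members S p (star-isStarSet S p idem A∈p) (F⊆T f∈F))

  -- The new index consists of all `f ⌢ x` with `f` in `F`. It is admissible because `x ∈ 𝒜 F` says
  -- exactly that each such extension is in `T`.
  shift : ∀ F {x} → x ∈ 𝒜 F → ∃[ G ] (𝒜 G ⊆ translate S x (𝒜 F))
  shift (F , F⊆T) {x} x∈ =
    (map⁺ (_⌢ x) F , extensions⊆T)
    , λ t∈ → translate-⋂ S F
        (λ f∈F → B-tree-⌢ S (F⊆T f∈F) (t∈ (∈-map⁺ (_⌢ x) f∈F)))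
    where
    extensions⊆T : ⟦ map⁺ (_⌢ x) F ⟧ ⊆ T
    extensions⊆T g∈ with _ , f∈F , refl ← ∈-map⁻ (_⌢ x) g∈ = x∈ f∈F
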